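{- Let $M$ be a matrix with nonnegative real entries, and let $N$ be a real rank-$r$ matrix of the same dimensions such that $M_{ij}=N_{ij}^2$ for all $i,j$. Then there exists a one-way quantum protocol using $(r+1)$-dimensional pure-state messages that computes $M$ in expectation.
   Context: All matrices are real; PSD means symmetric positive semidefinite. A $D$-dimensional quantum state is a $D\times D$ PSD matrix $\rho$ of trace $1$; it is a pure state if it has rank $1$, i.e. $\rho=\phi\phi^{\intercal}$ for a unit column vector $\phi\in\mathbb{R}^D$. A POVM in dimension $D$ is a finite family $\{E_\theta\}_{\theta\in\Theta}$ of $D\times D$ PSD matrices, labeled by distinct real numbers $\theta$, with $\sum_\theta E_\theta=I$; measuring $\rho$ yields outcome $\theta$ with probability $\operatorname{Tr}[E_\theta\rho]$. A one-way quantum protocol with $D$-dimensional messages consists of a $D$-dimensional state $\rho_i$ for each row index $i$ (sent by Alice on input $i$) and, for each column index $j$, a POVM $\{E^j_\theta\}$ in dimension $D$ whose labels $\theta$ are all nonnegative (with which Bob, on input $j$, measures the received state, outputting the outcome). It uses pure-state messages if every $\rho_i$ is pure. It computes $M$ in expectation if the expected output $\sum_\theta\theta\operatorname{Tr}[E^j_\theta\rho_i]$ equals $M_{ij}$ for all $i,j$. -}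

module Defs where

open import Algebra.Bundles using (CommutativeRing; Semiring)
open import Algebra.Structures using (IsCommutativeRing)
import Algebra.Properties.Semiring.Sum as SemiringSum
open import Data.Bool.Base using (if_then_else_)
open import Data.Fin.Base using (Fin)
open import Data.Fin.Properties using () renaming (_≟_ to _≟ᶠ_)
open import Data.Nat.Base using (ℕ)
open import Data.Product.Base using (∃; _×_)
open import Data.Vec.Functional using (Vector)
open import Function.Definitions using (Injective)
open import Level using (0ℓ)
open import Relation.Binary.Core using (Rel)
open import Relation.Binary.PropositionalEquality.Core using (_≡_)
open import Relation.Binary.Structures using (IsDecTotalOrder)
open import Relation.Nullary.Decidable.Core using (does)
open import Relation.Nullary.Negation.Core using (¬_)

-- The standard library has no real numbers, so they are specified axiomatically
-- as a Dedekind-complete ordered field, which determines them up to unique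
-- isomorphism. These are the classical reals: equality and order are decidable,
-- and every inhabited set that is bounded above has a least upper bound.

record RealNumbers : Set₁ where
  infix  4 _≈_ _≤_
  infixl 6 _+_
  infixl 7 _*_
  infix  8 -_
  field
    Carrier           : Set
    _≈_               : Rel Carrier 0ℓ
    _≤_               : Rel Carrier 0ℓ
    _+_ _*_           : Carrier → Carrier → Carrier
    -_                : Carrier → Carrier
    0# 1#             : Carrier
    isCommutativeRing : IsCommutativeRing _≈_ _+_ _*_ -_ 0# 1#
    1≉0               : ¬ (1# ≈ 0#)
    *-inverse         : ∀ x → ¬ (x ≈ 0#) → ∃ λ y → x * y ≈ 1#
    isDecTotalOrder   : IsDecTotalOrder _≈_ _≤_
    +-monoˡ-≤         : ∀ {x y} z → x ≤ y → x + z ≤ y + z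
    *-nonneg          : ∀ {x y} → 0# ≤ x → 0# ≤ y → 0# ≤ x * y

  IsUpperBound : (Carrier → Set) → Carrier → Set
  IsUpperBound P u = ∀ x → P x → x ≤ u

  field
    supremum : ∀ (P : Carrier → Set) → ∃ P → ∃ (IsUpperBound P) →
               ∃ λ s → IsUpperBound P s × (∀ u → IsUpperBound P u → s ≤ u)

  commutativeRing : CommutativeRing 0ℓ 0ℓ
  commutativeRing = record { isCommutativeRing = isCommutativeRing }

  semiring : Semiring 0ℓ 0ℓ
  semiring = CommutativeRing.semiring commutativeRing

module QuantumProtocols (ℝ : RealNumbers) where

  open RealNumbers ℝ
  open SemiringSum semiring using (sum-syntax)

  Vec : ℕ → Set
  Vec n = Vector Carrier n

  Matrix : ℕ → ℕ → Set
  Matrix m n = Fin m → Fin n → Carrier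

  infix 4 _≈ᴹ_
  _≈ᴹ_ : ∀ {m n} → Matrix m n → Matrix m n → Set
  A ≈ᴹ B = ∀ i j → A i j ≈ B i j

  infixl 7 _*ᴹ_
  _*ᴹ_ : ∀ {l m n} → Matrix l m → Matrix m n → Matrix l n
  _*ᴹ_ {m = m} A B i k = ∑[ j < m ] (A i j * B j k)

  identity : ∀ {n} → Matrix n n
  identity i j = if does (i ≟ᶠ j) then 1# else 0#

  trace : ∀ {n} → Matrix n n → Carrier
  trace {n} A = ∑[ i < n ] A i i

  ∑ᴹ : ∀ {m n k} → (Fin k → Matrix m n) → Matrix m n
  ∑ᴹ {k = k} A i j = ∑[ t < k ] A t i j

  outer : ∀ {n} → Vec n → Matrix n n
  outer φ i j = φ i * φ j

  IsUnit : ∀ {n} → Vec n → Set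
  IsUnit {n} φ = ∑[ i < n ] (φ i * φ i) ≈ 1#

  linearCombination : ∀ {n k} → Vec k → (Fin k → Vec n) → Vec n
  linearCombination {k = k} c b i = ∑[ l < k ] (c l * b l i)

  LinearlyIndependent : ∀ {n k} → (Fin k → Vec n) → Set
  LinearlyIndependent {n} {k} b =
    ∀ (c : Vec k) → (∀ i → linearCombination c b i ≈ 0#) → ∀ l → c l ≈ 0#

  record IsBasis {n k : ℕ} (V : Vec n → Set) (b : Fin k → Vec n) : Set where
    field
      member      : ∀ l → V (b l)
      independent : LinearlyIndependent b
      spanning    : ∀ v → V v → ∃ λ c → ∀ i → v i ≈ linearCombination c b i

  ColumnSpace : ∀ {m n} → Matrix m n → Vec m → Set
  ColumnSpace {m} {n} A v = ∃ λ (x : Vec n) → ∀ i → v i ≈ ∑[ j < n ] (A i j * x j)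

  -- The rank is the dimension of the column space.
  HasRank : ∀ {m n} → Matrix m n → ℕ → Set
  HasRank {m} A r = ∃ λ (b : Fin r → Vec m) → IsBasis (ColumnSpace A) b

  quadraticForm : ∀ {n} → Matrix n n → Vec n → Carrier
  quadraticForm {n} A x = ∑[ i < n ] ∑[ j < n ] (x i * A i j * x j)

  record PSD {n : ℕ} (A : Matrix n n) : Set where
    field
      symmetric    : ∀ i j → A i j ≈ A j i
      semidefinite : ∀ x → 0# ≤ quadraticForm A x

  record IsState {D : ℕ} (ρ : Matrix D D) : Set where
    field
      psd       : PSD ρ
      unitTrace : trace ρ ≈ 1#

  -- For a state the last two fields are equivalent; both are required so that
  -- either description of purity can be read off.
  record IsPureState {D : ℕ} (ρ : Matrix D D) : Set where
    field
      isState      : IsState ρ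
      rankOne      : HasRank ρ 1
      outerProduct : ∃ λ (φ : Vec D) → IsUnit φ × ρ ≈ᴹ outer φ

  -- The index set is Fin size; injectivity of label makes the outcomes distinct reals.
  record POVM (D : ℕ) : Set where
    field
      size           : ℕ
      label          : Fin size → Carrier
      label-distinct : Injective _≡_ _≈_ label
      element        : Fin size → Matrix D D
      element-psd    : ∀ t → PSD (element t)
      complete       : ∑ᴹ element ≈ᴹ identity

    probability : Matrix D D → Fin size → Carrier
    probability ρ t = trace (element t *ᴹ ρ)

    expectation : Matrix D D → Carrier
    expectation ρ = ∑[ t < size ] (label t * probability ρ t)

  record Protocol (m n D : ℕ) : Set where
    field
      message        : Fin m → Matrix D D
      message-state  : ∀ i → IsState (message i)
      measurement    : Fin n → POVM D
      outcome-nonneg : ∀ j t → 0# ≤ POVM.label (measurement j) t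

    UsesPureStates : Set
    UsesPureStates = ∀ i → IsPureState (message i)

    ComputesInExpectation : Matrix m n → Set
    ComputesInExpectation M = ∀ i j → POVM.expectation (measurement j) (message i) ≈ M i j

{-# OPTIONS --safe #-}

-- Factor N through its rank as N i j = ⟨ c j , b i ⟩ with c j and b i in ℝʳ.
-- A common factor α shrinks all α b i into the unit ball, and an extra coordinate
-- s i with s i² + |α b i|² = 1 makes them unit vectors φ i in ℝʳ⁺¹. With
-- w j = (0 , c j / α) we get ⟨ w j , φ i ⟩ = N i j, so a measurement whose mean
-- observable Σ θ E_θ is w wᵀ has expected outcome ⟨ w j , φ i ⟩² = M i j. For
-- K = 1 + |w|² such a measurement is w wᵀ / K with label K and I − w wᵀ / K with
-- label 0; the latter is PSD because, with a = ⟨ w , x ⟩ / K,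
-- |x|² − ⟨ w , x ⟩² / K = |x − a w|² + a².
module Submission where

open import Defs
open import Algebra.Bundles using (CommutativeRing)
import Algebra.Properties.Ring as RingProperties
import Algebra.Properties.Semiring.Sum as SemiringSum
import Algebra.Solver.Ring.NaturalCoefficients.Default as Solver
open import Data.Fin.Base using (Fin; zero; suc)
open import Data.Nat.Base using (ℕ; zero; suc)
open import Data.Product.Base using (Σ; ∃; _×_; _,_; proj₁; proj₂)
open import Data.Sum.Base using (inj₁; inj₂)
open import Data.Vec.Functional using (_∷_)
open import Relation.Binary.Bundles using (Poset)
open import Relation.Binary.PropositionalEquality.Core as ≡ using (_≡_)
import Relation.Binary.Reasoning.PartialOrder as PosetReasoning
open import Relation.Binary.Structures using (IsDecTotalOrder)
open import Relation.Nullary.Negation.Core using (¬_; contradiction)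

-- Arithmetic and order in an ordered field.

module OrderedField (ℝ : RealNumbers) where

  open RealNumbers ℝ
  open CommutativeRing commutativeRing public using
    ( refl; sym; trans; ring; commutativeSemiring
    ; +-cong; +-congˡ; +-congʳ; +-comm; +-assoc; +-identityˡ; +-identityʳ; -‿inverseʳ
    ; *-cong; *-congˡ; *-congʳ; *-comm; *-assoc; *-identityˡ; *-identityʳ
    ; zeroˡ; zeroʳ; distribˡ; distribʳ )
  open RingProperties ring public using
    (-‿distribˡ-*; -‿distribʳ-*; -‿involutive; +-cancelʳ)
  open IsDecTotalOrder isDecTotalOrder public using (isPartialOrder; total; antisym)
    renaming (refl to ≤-refl; trans to ≤-trans; ≤-respʳ-≈ to ≤-respʳ; ≤-respˡ-≈ to ≤-respˡ)
  open Solver commutativeSemiring public using (solve; _:=_; _:+_; _:*_; con)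

  poset : Poset _ _ _
  poset = record { isPartialOrder = isPartialOrder }

  module ≤-Reasoning = PosetReasoning poset
  open ≤-Reasoning

  +-monoʳ-≤ : ∀ x {y z} → y ≤ z → x + y ≤ x + z
  +-monoʳ-≤ x {y} {z} y≤z = begin
    x + y  ≈⟨ +-comm x y ⟩
    y + x  ≤⟨ +-monoˡ-≤ x y≤z ⟩
    z + x  ≈⟨ +-comm z x ⟩
    x + z  ∎

  +-mono-≤ : ∀ {x y u v} → x ≤ y → u ≤ v → x + u ≤ y + v
  +-mono-≤ x≤y u≤v = ≤-trans (+-monoˡ-≤ _ x≤y) (+-monoʳ-≤ _ u≤v)

  +-nonneg : ∀ {x y} → 0# ≤ x → 0# ≤ y → 0# ≤ x + y
  +-nonneg 0≤x 0≤y = ≤-respˡ (+-identityˡ 0#) (+-mono-≤ 0≤x 0≤y)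

  x≤x+y : ∀ {x y} → 0# ≤ y → x ≤ x + y
  x≤x+y {x} 0≤y = ≤-respˡ (+-identityʳ x) (+-monoʳ-≤ x 0≤y)

  x≤y+x : ∀ {x y} → 0# ≤ y → x ≤ y + x
  x≤y+x {x} 0≤y = ≤-respˡ (+-identityˡ x) (+-monoˡ-≤ x 0≤y)

  x≤y⇒0≤y-x : ∀ {x y} → x ≤ y → 0# ≤ y + - x
  x≤y⇒0≤y-x {x} x≤y = ≤-respˡ (-‿inverseʳ x) (+-monoˡ-≤ (- x) x≤y)

  x+[y-x]≈y : ∀ x y → x + (y + - x) ≈ y
  x+[y-x]≈y x y = begin-equality
    x + (y + - x)  ≈⟨ solve 3 (λ x y z → x :+ (y :+ z) := y :+ (x :+ z)) refl x y (- x) ⟩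
    y + (x + - x)  ≈⟨ +-congˡ (-‿inverseʳ x) ⟩
    y + 0#         ≈⟨ +-identityʳ y ⟩
    y              ∎

  *-monoʳ-≤ : ∀ {z x y} → 0# ≤ z → x ≤ y → z * x ≤ z * y
  *-monoʳ-≤ {z} {x} {y} 0≤z x≤y = begin
    z * x                      ≤⟨ x≤x+y (*-nonneg 0≤z (x≤y⇒0≤y-x x≤y)) ⟩
    z * x + z * (y + - x)      ≈⟨ distribˡ z x (y + - x) ⟨
    z * (x + (y + - x))        ≈⟨ *-congˡ (x+[y-x]≈y x y) ⟩
    z * y                      ∎

  square-mono-≤ : ∀ {x y} → 0# ≤ x → x ≤ y → x * x ≤ y * y
  square-mono-≤ {x} {y} 0≤x x≤y = begin
    x * x  ≤⟨ *-monoʳ-≤ 0≤x x≤y ⟩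
    x * y  ≈⟨ *-comm x y ⟩
    y * x  ≤⟨ *-monoʳ-≤ (≤-trans 0≤x x≤y) x≤y ⟩
    y * y  ∎

  square-nonneg : ∀ x → 0# ≤ x * x
  square-nonneg x with total 0# x
  ... | inj₁ 0≤x = *-nonneg 0≤x 0≤x
  ... | inj₂ x≤0 = ≤-respʳ [-x][-x]≈xx (*-nonneg 0≤-x 0≤-x)
    where
    0≤-x : 0# ≤ - x
    0≤-x = ≤-respʳ (+-identityˡ (- x)) (x≤y⇒0≤y-x x≤0)

    [-x][-x]≈xx : - x * - x ≈ x * x
    [-x][-x]≈xx = begin-equality
      - x * - x    ≈⟨ -‿distribʳ-* (- x) x ⟨
      - (- x * x)  ≈⟨ -‿distribˡ-* (- x) x ⟩
      - - x * x    ≈⟨ *-congʳ (-‿involutive x) ⟩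
      x * x        ∎

  0≤1 : 0# ≤ 1#
  0≤1 = ≤-respʳ (*-identityˡ 1#) (square-nonneg 1#)

  1≤x⇒0≤x : ∀ {x} → 1# ≤ x → 0# ≤ x
  1≤x⇒0≤x = ≤-trans 0≤1

  1≤x⇒x≉0 : ∀ {x} → 1# ≤ x → ¬ (x ≈ 0#)
  1≤x⇒x≉0 1≤x x≈0 = 1≉0 (antisym (≤-respʳ x≈0 1≤x) 0≤1)

  -- Since `x * y` is `1#`, `y` equals `x * (y * y)`, a product of nonnegative factors; no case
  -- split on the sign of `y` arises.
  inverse-nonneg : ∀ {x y} → 0# ≤ x → x * y ≈ 1# → 0# ≤ y
  inverse-nonneg {x} {y} 0≤x xy≈1 = begin
    0#           ≤⟨ *-nonneg 0≤x (square-nonneg y) ⟩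
    x * (y * y)  ≈⟨ *-assoc x y y ⟨
    x * y * y    ≈⟨ *-congʳ xy≈1 ⟩
    1# * y       ≈⟨ *-identityˡ y ⟩
    y            ∎

  -- Square roots from completeness.

  -- The Knaster–Tarski argument: the supremum of the post-fixed points.
  monotone-fixpoint : (g : Carrier → Carrier) → 0# ≤ g 0# → g 1# ≤ 1# →
                      (∀ {x y} → 0# ≤ x → x ≤ y → g x ≤ g y) →
                      ∃ λ t → g t ≈ t
  monotone-fixpoint g 0≤g0 g1≤1 mono = s , antisym (upper (g s) gs∈S) s≤gs
    where
    S : Carrier → Set
    -- The lower bound keeps to the range where `g` is assumed monotone; the upper bound makes the
    -- supremum available.
    S t = 0# ≤ t × t ≤ 1# × t ≤ g t

    0∈S : S 0#
    0∈S = ≤-refl , 0≤1 , 0≤g0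

    lub : _
    lub = supremum S (0# , 0∈S) (1# , λ _ t∈S → proj₁ (proj₂ t∈S))

    s : Carrier
    s = proj₁ lub

    upper : IsUpperBound S s
    upper = proj₁ (proj₂ lub)

    least : ∀ u → IsUpperBound S u → s ≤ u
    least = proj₂ (proj₂ lub)

    0≤s : 0# ≤ s
    0≤s = upper 0# 0∈S

    s≤1 : s ≤ 1#
    s≤1 = least 1# λ _ t∈S → proj₁ (proj₂ t∈S)

    s≤gs : s ≤ g s
    s≤gs = least (g s) λ t t∈S →
      ≤-trans (proj₂ (proj₂ t∈S)) (mono (proj₁ t∈S) (upper t t∈S))

    gs∈S : S (g s)
    gs∈S = ≤-trans 0≤s s≤gs , ≤-trans (mono 0≤s s≤1) g1≤1 , mono 0≤s s≤gs

  -- With s = 1 − t the equation s² = 1 − b reads t = (b + t²) / 2, whose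
  -- right-hand side maps [0,1] monotonically to itself.
  unit-complement : ∀ b → 0# ≤ b → b ≤ 1# → ∃ λ s → s * s + b ≈ 1#
  -- Adding `t * t` to both sides and writing `1#` as `s + t` removes all subtraction, so what
  -- remains is a semiring identity that the solver can check.
  unit-complement b 0≤b b≤1 = s , +-cancelʳ (t * t) (s * s + b) 1# (begin-equality
    s * s + b + t * t                    ≈⟨ +-assoc (s * s) b (t * t) ⟩
    s * s + (b + t * t)                  ≈⟨ +-congˡ b+t²≈2t ⟩
    s * s + (1# + 1#) * t                ≈⟨ +-congˡ (*-congˡ (*-identityʳ t)) ⟨
    s * s + (1# + 1#) * (t * 1#)         ≈⟨ +-congˡ (*-congˡ (*-congˡ s+t≈1)) ⟨
    s * s + (1# + 1#) * (t * (s + t))    ≈⟨ solve 2 (λ s t →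
                                              s :* s :+ con 2 :* (t :* (s :+ t)) :=
                                              (s :+ t) :* (s :+ t) :+ t :* t) refl s t ⟩
    (s + t) * (s + t) + t * t            ≈⟨ +-congʳ (*-cong s+t≈1 s+t≈1) ⟩
    1# * 1# + t * t                      ≈⟨ +-congʳ (*-identityˡ 1#) ⟩
    1# + t * t                           ∎)
    where
    1≤2 : 1# ≤ 1# + 1#
    1≤2 = x≤x+y 0≤1

    half : ∃ λ h → (1# + 1#) * h ≈ 1#
    half = *-inverse (1# + 1#) (1≤x⇒x≉0 1≤2)

    h : Carrier
    h = proj₁ half

    0≤h : 0# ≤ h
    0≤h = inverse-nonneg (1≤x⇒0≤x 1≤2) (proj₂ half)

    g : Carrier → Carrier
    g t = h * (b + t * t)

    g1≤1 : g 1# ≤ 1#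
    g1≤1 = begin
      h * (b + 1# * 1#)  ≈⟨ *-congˡ (+-congˡ (*-identityˡ 1#)) ⟩
      h * (b + 1#)       ≤⟨ *-monoʳ-≤ 0≤h (+-monoˡ-≤ 1# b≤1) ⟩
      h * (1# + 1#)      ≈⟨ *-comm h (1# + 1#) ⟩
      (1# + 1#) * h      ≈⟨ proj₂ half ⟩
      1#                 ∎

    fixpoint : ∃ λ t → g t ≈ t
    fixpoint = monotone-fixpoint g
      (*-nonneg 0≤h (+-nonneg 0≤b (square-nonneg 0#))) g1≤1
      λ 0≤x x≤y → *-monoʳ-≤ 0≤h (+-monoʳ-≤ b (square-mono-≤ 0≤x x≤y))

    t s : Carrier
    t = proj₁ fixpoint
    s = 1# + - t

    s+t≈1 : s + t ≈ 1#
    s+t≈1 = trans (+-comm s t) (x+[y-x]≈y t 1#)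

    b+t²≈2t : b + t * t ≈ (1# + 1#) * t
    b+t²≈2t = begin-equality
      b + t * t                      ≈⟨ *-identityˡ (b + t * t) ⟨
      1# * (b + t * t)               ≈⟨ *-congʳ (proj₂ half) ⟨
      (1# + 1#) * h * (b + t * t)    ≈⟨ *-assoc (1# + 1#) h (b + t * t) ⟩
      (1# + 1#) * g t                ≈⟨ *-congˡ (proj₂ fixpoint) ⟩
      (1# + 1#) * t                  ∎

module LinearAlgebra (ℝ : RealNumbers) where

  open RealNumbers ℝ
  open QuantumProtocols ℝ
  open OrderedField ℝ
  open SemiringSum semiring using
    (sum-syntax; sum-cong-≋; ∑-distrib-+; *-distribˡ-sum; *-distribʳ-sum)
  open ≤-Reasoning

  -- Finite sums and dot products.

  infix 8 _·_
  _·_ : ∀ {n} → Vec n → Vec n → Carrier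
  _·_ {n} x y = ∑[ i < n ] (x i * y i)

  infixl 6 _+ᴹ_
  _+ᴹ_ : ∀ {m n} → Matrix m n → Matrix m n → Matrix m n
  (A +ᴹ B) i j = A i j + B i j

  infixl 7 _*ₗᴹ_
  _*ₗᴹ_ : ∀ {m n} → Carrier → Matrix m n → Matrix m n
  (a *ₗᴹ A) i j = a * A i j

  ∑-zero : ∀ {n} {f : Vec n} → (∀ i → f i ≈ 0#) → ∑[ i < n ] f i ≈ 0#
  ∑-zero {zero} f≈0 = refl
  ∑-zero {suc n}  f≈0 =
    trans (+-cong (f≈0 zero) (∑-zero λ i → f≈0 (suc i))) (+-identityˡ 0#)

  ∑-nonneg : ∀ {n} {f : Vec n} → (∀ i → 0# ≤ f i) → 0# ≤ ∑[ i < n ] f i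
  ∑-nonneg {zero} 0≤f = ≤-refl
  ∑-nonneg {suc n}  0≤f = +-nonneg (0≤f zero) (∑-nonneg λ i → 0≤f (suc i))

  term≤∑ : ∀ {n} {f : Vec n} → (∀ i → 0# ≤ f i) → ∀ i → f i ≤ ∑[ i < n ] f i
  term≤∑ 0≤f zero    = x≤x+y (∑-nonneg λ i → 0≤f (suc i))
  term≤∑ 0≤f (suc i) = ≤-trans (term≤∑ (λ i → 0≤f (suc i)) i) (x≤y+x (0≤f zero))

  ∑∑-product : ∀ {m n} (f : Vec m) (g : Vec n) →
               ∑[ i < m ] ∑[ j < n ] (f i * g j) ≈ ∑[ i < m ] f i * ∑[ j < n ] g j
  ∑∑-product {m} {n} f g = begin-equality
    ∑[ i < m ] ∑[ j < n ] (f i * g j)    ≈⟨ sum-cong-≋ (λ i → *-distribˡ-sum (f i) g) ⟨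
    ∑[ i < m ] (f i * ∑[ j < n ] g j)    ≈⟨ *-distribʳ-sum (∑[ j < n ] g j) f ⟨
    ∑[ i < m ] f i * ∑[ j < n ] g j      ∎

  ∑-identity : ∀ {n} (f : Vec n) i → ∑[ j < n ] (f j * identity i j) ≈ f i
  ∑-identity f zero = begin-equality
    f zero * 1# + _  ≈⟨ +-cong (*-identityʳ (f zero)) (∑-zero λ j → zeroʳ (f (suc j))) ⟩
    f zero + 0#      ≈⟨ +-identityʳ (f zero) ⟩
    f zero           ∎
  -- `identity (suc i) (suc j)` reduces to `identity i j`, so the tail of the sum is already an
  -- instance of the induction hypothesis.
  ∑-identity f (suc i) = begin-equality
    f zero * 0# + _  ≈⟨ +-cong (zeroʳ (f zero)) (∑-identity (λ j → f (suc j)) i) ⟩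
    0# + f (suc i)   ≈⟨ +-identityˡ (f (suc i)) ⟩
    f (suc i)        ∎

  identity-symmetric : ∀ {n} (i j : Fin n) → identity i j ≈ identity j i
  identity-symmetric zero    zero    = refl
  identity-symmetric zero    (suc j) = refl
  identity-symmetric (suc i) zero    = refl
  identity-symmetric (suc i) (suc j) = identity-symmetric i j

  ·-nonneg : ∀ {n} (x : Vec n) → 0# ≤ x · x
  ·-nonneg x = ∑-nonneg λ i → square-nonneg (x i)

  ·-scale : ∀ {n} a b (x y : Vec n) →
            (λ i → a * x i) · (λ i → b * y i) ≈ a * b * (x · y)
  ·-scale a b x y = trans
    (sum-cong-≋ λ i → solve 4 (λ a b x y → a :* x :* (b :* y) := a :* b :* (x :* y))
                        refl a b (x i) (y i))
    (sym (*-distribˡ-sum (a * b) λ i → x i * y i))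

  -- Quadratic forms and positive semidefiniteness.

  quadraticForm-+ : ∀ {n} (A B : Matrix n n) x →
                    quadraticForm (A +ᴹ B) x ≈ quadraticForm A x + quadraticForm B x
  quadraticForm-+ {n} A B x = begin-equality
    quadraticForm (A +ᴹ B) x
      ≈⟨ sum-cong-≋ (λ i → trans
           (sum-cong-≋ λ j → trans (*-congʳ (distribˡ (x i) (A i j) (B i j)))
                                   (distribʳ (x j) (x i * A i j) (x i * B i j)))
           (∑-distrib-+ (λ j → x i * A i j * x j) (λ j → x i * B i j * x j))) ⟩
    ∑[ i < n ] (∑[ j < n ] (x i * A i j * x j) + ∑[ j < n ] (x i * B i j * x j))
      ≈⟨ ∑-distrib-+ (λ i → ∑[ j < n ] (x i * A i j * x j)) _ ⟩
    quadraticForm A x + quadraticForm B x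
      ∎

  quadraticForm-identity : ∀ {n} (x : Vec n) → quadraticForm identity x ≈ x · x
  quadraticForm-identity x = sum-cong-≋ λ i → trans
    (sum-cong-≋ λ j → solve 3 (λ u v w → u :* v :* w := u :* w :* v) refl
                        (x i) (identity i j) (x j))
    (∑-identity (λ j → x i * x j) i)

  -- Each summand splits into a factor in `i` times a factor in `j`, so the double sum is a product
  -- of two sums.
  quadraticForm-outer : ∀ {n} a (w x : Vec n) →
                        quadraticForm (a *ₗᴹ outer w) x ≈ a * ((w · x) * (w · x))
  quadraticForm-outer {n} a w x = begin-equality
    quadraticForm (a *ₗᴹ outer w) x
      ≈⟨ sum-cong-≋ (λ i → sum-cong-≋ λ j →
           solve 5 (λ a u v y z → y :* (a :* (u :* v)) :* z := a :* (u :* y) :* (v :* z))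
             refl a (w i) (w j) (x i) (x j)) ⟩
    ∑[ i < n ] ∑[ j < n ] (a * (w i * x i) * (w j * x j))
      ≈⟨ ∑∑-product (λ i → a * (w i * x i)) (λ j → w j * x j) ⟩
    ∑[ i < n ] (a * (w i * x i)) * (w · x)
      ≈⟨ *-congʳ (*-distribˡ-sum a λ i → w i * x i) ⟨
    a * (w · x) * (w · x)
      ≈⟨ *-assoc a (w · x) (w · x) ⟩
    a * ((w · x) * (w · x))
      ∎

  -- Written out in indices, the trace of a matrix times `outer φ` is the quadratic form of that
  -- matrix at `φ`. This gives the outcome probabilities of a rank-one effect on a pure state.
  trace-outer : ∀ {n} a (w φ : Vec n) →
                trace ((a *ₗᴹ outer w) *ᴹ outer φ) ≈ a * ((w · φ) * (w · φ))
  trace-outer a w φ = trans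
    (sum-cong-≋ λ i → sum-cong-≋ λ j →
      solve 5 (λ a u v y z → a :* (u :* v) :* (z :* y) := y :* (a :* (u :* v)) :* z)
        refl a (w i) (w j) (φ i) (φ j))
    (quadraticForm-outer a w φ)

  outer-psd : ∀ {n} {a} → 0# ≤ a → (w : Vec n) → PSD (a *ₗᴹ outer w)
  outer-psd {a = a} 0≤a w = record
    { symmetric    = λ i j → *-congˡ (*-comm (w i) (w j))
    ; semidefinite = λ x → ≤-respʳ (sym (quadraticForm-outer a w x))
                             (*-nonneg 0≤a (square-nonneg (w · x)))
    }

  -- With d = − c ⟨ w , x ⟩ the quadratic form at x is |x + d w|² + d².
  complement-psd : ∀ {n} {c} (w : Vec n) → (1# + w · w) * c ≈ 1# →
                   PSD (identity +ᴹ (- c) *ₗᴹ outer w)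
  complement-psd {n} {c} w Kc≈1 = record
    { symmetric    = λ i j → +-cong (identity-symmetric i j)
                                    (*-congˡ (*-comm (w i) (w j)))
    ; semidefinite = λ x → ≤-respʳ (sym (form x))
                             (+-nonneg (·-nonneg (λ i → x i + d x * w i))
                                       (square-nonneg (d x)))
    }
    where
    d : Vec n → Carrier
    d x = - c * (w · x)

    shifted-norm : ∀ x → (λ i → x i + d x * w i) · (λ i → x i + d x * w i) ≈
                         x · x + (1# + 1#) * d x * (w · x) + d x * d x * (w · w)
    shifted-norm x = begin-equality
      ∑[ i < n ] ((x i + d x * w i) * (x i + d x * w i))
        ≈⟨ sum-cong-≋ (λ i → solve 3 (λ x d w →
             (x :+ d :* w) :* (x :+ d :* w) :=
             x :* x :+ con 2 :* d :* (w :* x) :+ d :* d :* (w :* w))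
             refl (x i) (d x) (w i)) ⟩
      ∑[ i < n ] (x i * x i + (1# + 1#) * d x * (w i * x i) + d x * d x * (w i * w i))
        ≈⟨ trans (∑-distrib-+ (λ i → x i * x i + (1# + 1#) * d x * (w i * x i)) _)
                 (+-congʳ (∑-distrib-+ (λ i → x i * x i) _)) ⟩
      x · x + ∑[ i < n ] ((1# + 1#) * d x * (w i * x i)) + ∑[ i < n ] (d x * d x * (w i * w i))
        ≈⟨ +-cong (+-congˡ (*-distribˡ-sum ((1# + 1#) * d x) λ i → w i * x i))
                  (*-distribˡ-sum (d x * d x) λ i → w i * w i) ⟨
      x · x + (1# + 1#) * d x * (w · x) + d x * d x * (w · w)
        ∎

    -- The only place where `c` must be the inverse of `1# + w · w`: it makes `d x` equal to minus
    -- `w · x` divided by that number.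
    Kd+wx≈0 : ∀ x → (1# + w · w) * d x + w · x ≈ 0#
    Kd+wx≈0 x = begin-equality
      (1# + w · w) * (- c * (w · x)) + w · x
        ≈⟨ +-congʳ (*-assoc (1# + w · w) (- c) (w · x)) ⟨
      (1# + w · w) * - c * (w · x) + w · x
        ≈⟨ +-congʳ (*-congʳ (-‿distribʳ-* (1# + w · w) c)) ⟨
      - ((1# + w · w) * c) * (w · x) + w · x
        ≈⟨ +-congʳ (-‿distribˡ-* ((1# + w · w) * c) (w · x)) ⟨
      - ((1# + w · w) * c * (w · x)) + w · x
        ≈⟨ +-congˡ (trans (*-congʳ Kc≈1) (*-identityˡ (w · x))) ⟨
      - ((1# + w · w) * c * (w · x)) + (1# + w · w) * c * (w · x)
        ≈⟨ trans (+-comm _ _) (-‿inverseʳ _) ⟩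
      0#
        ∎

    form : ∀ x → quadraticForm (identity +ᴹ (- c) *ₗᴹ outer w) x ≈
                 (λ i → x i + d x * w i) · (λ i → x i + d x * w i) + d x * d x
    form x = begin-equality
      quadraticForm (identity +ᴹ (- c) *ₗᴹ outer w) x
        ≈⟨ trans (quadraticForm-+ identity ((- c) *ₗᴹ outer w) x)
                 (+-cong (quadraticForm-identity x) (quadraticForm-outer (- c) w x)) ⟩
      x · x + - c * ((w · x) * (w · x))
        ≈⟨ +-congˡ (*-assoc (- c) (w · x) (w · x)) ⟨
      x · x + d x * (w · x)
        ≈⟨ +-identityʳ _ ⟨
      x · x + d x * (w · x) + 0#
        -- Completing the square: `d x` times the vanishing expression supplies the second cross
        -- term, the `w · w` term and the extra `d x * d x`.
        ≈⟨ +-congˡ (trans (*-congˡ (Kd+wx≈0 x)) (zeroʳ (d x))) ⟨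
      x · x + d x * (w · x) + d x * ((1# + w · w) * d x + w · x)
        ≈⟨ solve 4 (λ X W d s →
             X :+ d :* s :+ d :* ((con 1 :+ W) :* d :+ s) :=
             X :+ con 2 :* d :* s :+ d :* d :* W :+ d :* d)
             refl (x · x) (w · w) (d x) (w · x) ⟩
      x · x + (1# + 1#) * d x * (w · x) + d x * d x * (w · w) + d x * d x
        ≈⟨ +-congʳ (shifted-norm x) ⟨
      (λ i → x i + d x * w i) · (λ i → x i + d x * w i) + d x * d x
        ∎

  -- Rank-one projections as pure states.

  -- Applying `outer φ` to `x` gives `φ · x` times `φ`, so the column space is the line through `φ`.
  -- The unit norm puts `φ` itself on that line, as its own image, and makes it nonzero.
  outer-rank : ∀ {n} (φ : Vec n) → IsUnit φ → HasRank (outer φ) 1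
  outer-rank {n} φ unit = (λ _ → φ) , record
    { member      = λ _ → φ , λ i → sym (outer-fixes i)
    ; independent = λ { c cφ≈0 zero → coefficient-zero (c zero)
                          λ i → trans (sym (+-identityʳ (c zero * φ i))) (cφ≈0 i) }
    ; spanning    = λ { v (x , v≈Ax) → (λ _ → φ · x) , λ i → begin-equality
        v i                                ≈⟨ v≈Ax i ⟩
        ∑[ j < n ] (φ i * φ j * x j)       ≈⟨ outer-vector i x ⟩
        φ i * (φ · x)                      ≈⟨ *-comm (φ i) (φ · x) ⟩
        (φ · x) * φ i                      ≈⟨ +-identityʳ _ ⟨
        (φ · x) * φ i + 0#                 ∎ }
    }
    where
    outer-vector : ∀ i x → ∑[ j < n ] (φ i * φ j * x j) ≈ φ i * (φ · x)
    outer-vector i x = trans (sum-cong-≋ λ j → *-assoc (φ i) (φ j) (x j))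
                             (sym (*-distribˡ-sum (φ i) λ j → φ j * x j))

    outer-fixes : ∀ i → ∑[ j < n ] (φ i * φ j * φ j) ≈ φ i
    outer-fixes i = trans (outer-vector i φ) (trans (*-congˡ unit) (*-identityʳ (φ i)))

    -- Pairing the zero vector `c φ` with `φ` recovers `c`, so no nonzero coordinate of `φ` has to
    -- be located.
    coefficient-zero : ∀ c → (∀ i → c * φ i ≈ 0#) → c ≈ 0#
    coefficient-zero c cφ≈0 = begin-equality
      c                               ≈⟨ *-identityʳ c ⟨
      c * 1#                          ≈⟨ *-congˡ unit ⟨
      c * (φ · φ)                     ≈⟨ *-distribˡ-sum c (λ i → φ i * φ i) ⟩
      ∑[ i < n ] (c * (φ i * φ i))    ≈⟨ ∑-zero (λ i → trans (sym (*-assoc c (φ i) (φ i)))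
                                           (trans (*-congʳ (cφ≈0 i)) (zeroˡ (φ i)))) ⟩
      0#                              ∎

  unit⇒pure : ∀ {n} (φ : Vec n) → IsUnit φ → IsPureState (outer φ)
  unit⇒pure φ unit = record
    { isState      = record
      { psd       = record
        { symmetric    = λ i j → *-comm (φ i) (φ j)
        ; semidefinite = λ x → ≤-respʳ
            (sum-cong-≋ λ i → sum-cong-≋ λ j → *-congʳ (*-congˡ (*-identityˡ (outer φ i j))))
            (PSD.semidefinite (outer-psd 0≤1 φ) x)
        }
      -- The trace of `outer φ` and the squared norm in `IsUnit φ` are the same sum by definition.
      ; unitTrace = unit
      }
    ; rankOne      = outer-rank φ unit
    ; outerProduct = φ , unit , λ _ _ → refl
    }

  -- The row `identity j` is the standard basis vector that selects column `j`.
  column∈columnSpace : ∀ {m n} (A : Matrix m n) j → ColumnSpace A (λ i → A i j)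
  column∈columnSpace A j = identity j , λ i → sym (∑-identity (A i) j)

  -- The two-outcome measurement attached to a vector.

  module Measurement {D : ℕ} (w : Vec D) where

    -- The summand `1#` keeps `K` invertible and distinct from the other label `0#` even when `w` is
    -- zero.
    K : Carrier
    K = 1# + w · w

    1≤K : 1# ≤ K
    1≤K = x≤x+y (·-nonneg w)

    inverse : ∃ λ c → K * c ≈ 1#
    inverse = *-inverse K (1≤x⇒x≉0 1≤K)

    c : Carrier
    c = proj₁ inverse

    0≤c : 0# ≤ c
    0≤c = inverse-nonneg (1≤x⇒0≤x 1≤K) (proj₂ inverse)

    label : Fin 2 → Carrier
    label zero       = 0#
    label (suc zero) = K

    label-injective : ∀ {s t} → label s ≈ label t → s ≡ t
    label-injective {zero}     {zero}     _   = ≡.refl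
    label-injective {zero}     {suc zero} 0≈K = contradiction (sym 0≈K) (1≤x⇒x≉0 1≤K)
    label-injective {suc zero} {zero}     K≈0 = contradiction K≈0 (1≤x⇒x≉0 1≤K)
    label-injective {suc zero} {suc zero} _   = ≡.refl

    label-nonneg : ∀ t → 0# ≤ label t
    label-nonneg zero       = ≤-refl
    label-nonneg (suc zero) = 1≤x⇒0≤x 1≤K

    element : Fin 2 → Matrix D D
    element zero       = identity +ᴹ (- c) *ₗᴹ outer w
    element (suc zero) = c *ₗᴹ outer w

    povm : POVM D
    povm = record
      { size           = 2
      ; label          = label
      ; label-distinct = label-injective
      ; element        = element
      ; element-psd    = λ { zero       → complement-psd w (proj₂ inverse)
                           ; (suc zero) → outer-psd 0≤c w }
      ; complete       = λ i j → begin-equality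
          identity i j + - c * outer w i j + (c * outer w i j + 0#)
            ≈⟨ solve 3 (λ u v w → u :+ v :+ (w :+ con 0) := u :+ (w :+ v)) refl _ _ _ ⟩
          identity i j + (c * outer w i j + - c * outer w i j)
            ≈⟨ +-congˡ (distribʳ (outer w i j) c (- c)) ⟨
          identity i j + (c + - c) * outer w i j
            ≈⟨ +-congˡ (trans (*-congʳ (-‿inverseʳ c)) (zeroˡ (outer w i j))) ⟩
          identity i j + 0#
            ≈⟨ +-identityʳ _ ⟩
          identity i j
            ∎
      }

    -- The complementary outcome has label `0#` and contributes nothing; in the other term the label
    -- `K` cancels the scale `c` of its effect.
    expectation-outer : ∀ φ → POVM.expectation povm (outer φ) ≈ (w · φ) * (w · φ)
    expectation-outer φ = begin-equality
      0# * _ + (K * trace ((c *ₗᴹ outer w) *ᴹ outer φ) + 0#)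
        ≈⟨ trans (+-cong (zeroˡ _) (+-identityʳ _)) (+-identityˡ _) ⟩
      K * trace ((c *ₗᴹ outer w) *ᴹ outer φ)
        ≈⟨ *-congˡ (trace-outer c w φ) ⟩
      K * (c * ((w · φ) * (w · φ)))
        ≈⟨ *-assoc K c _ ⟨
      K * c * ((w · φ) * (w · φ))
        ≈⟨ trans (*-congʳ (proj₂ inverse)) (*-identityˡ _) ⟩
      (w · φ) * (w · φ)
        ∎

  -- Factorizations and the protocols built from them.

  pureProtocol : ∀ {m n D} (φ : Fin m → Vec D) → (∀ i → IsUnit (φ i)) →
                 (Fin n → Vec D) → Protocol m n D
  pureProtocol φ unit w = record
    { message        = λ i → outer (φ i)
    ; message-state  = λ i → IsPureState.isState (unit⇒pure (φ i) (unit i))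
    ; measurement    = λ j → Measurement.povm (w j)
    ; outcome-nonneg = λ j → Measurement.label-nonneg (w j)
    }

  -- Every column of `N` expands in a basis of the column space. The coordinates of column `j` form
  -- its vector, and the `i`-th entries of the basis vectors form the vector of row `i`.
  rank-factorization : ∀ {m n r} (N : Matrix m n) → HasRank N r →
                       ∃ λ (b : Fin m → Vec r) → ∃ λ (c : Fin n → Vec r) →
                       ∀ i j → N i j ≈ c j · b i
  rank-factorization N (b , basis) =
    (λ i l → b l i) , (λ j → proj₁ (column j)) , λ i j → proj₂ (column j) i
    where
    column : ∀ j → _
    column j = IsBasis.spanning basis (λ i → N i j) (column∈columnSpace N j)

  -- With `T` one more than the sum of all `f i`, each `f i` is at most `T`, and `T` is at most its
  -- square because it is at least `1#`. Dividing by the square of `T` therefore needs no square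
  -- root and no maximum. The inverse `T` of `α` is returned as well, to undo the scaling on the
  -- other factor.
  common-scale : ∀ {m} (f : Vec m) → (∀ i → 0# ≤ f i) →
                 ∃ λ T → ∃ λ α → T * α ≈ 1# × (∀ i → α * α * f i ≤ 1#)
  common-scale {m} f 0≤f = T , α , Tα≈1 , λ i → begin
    α * α * f i        ≤⟨ *-monoʳ-≤ (square-nonneg α) (fᵢ≤T² i) ⟩
    α * α * (T * T)    ≈⟨ solve 2 (λ a t → a :* a :* (t :* t) := t :* a :* (t :* a)) refl α T ⟩
    T * α * (T * α)    ≈⟨ *-cong Tα≈1 Tα≈1 ⟩
    1# * 1#            ≈⟨ *-identityˡ 1# ⟩
    1#                 ∎
    where
    T : Carrier
    T = 1# + ∑[ i < m ] f i

    1≤T : 1# ≤ T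
    1≤T = x≤x+y (∑-nonneg 0≤f)

    inverse : ∃ λ α → T * α ≈ 1#
    inverse = *-inverse T (1≤x⇒x≉0 1≤T)

    α : Carrier
    α = proj₁ inverse

    Tα≈1 : T * α ≈ 1#
    Tα≈1 = proj₂ inverse

    fᵢ≤T² : ∀ i → f i ≤ T * T
    fᵢ≤T² i = begin
      f i                ≤⟨ term≤∑ 0≤f i ⟩
      ∑[ i < m ] f i     ≤⟨ x≤y+x 0≤1 ⟩
      T                  ≈⟨ *-identityʳ T ⟨
      T * 1#             ≤⟨ *-monoʳ-≤ (1≤x⇒0≤x 1≤T) 1≤T ⟩
      T * T              ∎

  unit-factorization : ∀ {m n r} (N : Matrix m n) → HasRank N r →
                       ∃ λ (φ : Fin m → Vec (suc r)) → ∃ λ (w : Fin n → Vec (suc r)) →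
                       (∀ i → IsUnit (φ i)) × (∀ i j → N i j ≈ w j · φ i)
  unit-factorization {m} {n} {r} N rank
    with b , c , N≈cb ← rank-factorization N rank
    with T , α , Tα≈1 , bounded ← common-scale (λ i → b i · b i) (λ i → ·-nonneg (b i))
    = φ , w , unit , N≈wφ
    where
    complement : ∀ i → ∃ λ s → s * s + α * α * (b i · b i) ≈ 1#
    complement i = unit-complement (α * α * (b i · b i))
      (*-nonneg (square-nonneg α) (·-nonneg (b i))) (bounded i)

    φ : Fin m → Vec (suc r)
    φ i = proj₁ (complement i) ∷ λ l → α * b i l

    w : Fin n → Vec (suc r)
    -- The leading `0#` suppresses the coordinate that was added to normalize `φ i`, and `T` cancels
    -- `α`.
    w j = 0# ∷ λ l → T * c j l

    unit : ∀ i → IsUnit (φ i)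
    unit i = trans (+-congˡ (·-scale α α (b i) (b i))) (proj₂ (complement i))

    N≈wφ : ∀ i j → N i j ≈ w j · φ i
    N≈wφ i j = begin-equality
      N i j                            ≈⟨ N≈cb i j ⟩
      c j · b i                        ≈⟨ *-identityˡ _ ⟨
      1# * (c j · b i)                 ≈⟨ *-congʳ Tα≈1 ⟨
      T * α * (c j · b i)              ≈⟨ ·-scale T α (c j) (b i) ⟨
      _                                ≈⟨ +-identityˡ _ ⟨
      0# + _                           ≈⟨ +-congʳ (zeroˡ _) ⟨
      w j · φ i                        ∎

  -- The dimension is arbitrary here: rank enters only through the choice of factorization. Row `i`
  -- sends the pure state of `φ i`, column `j` measures along `w j`, and the mean is the squared
  -- pairing.
  factorization-protocol : ∀ {m n D} (M N : Matrix m n) (φ : Fin m → Vec D) (w : Fin n → Vec D) →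
                           (∀ i → IsUnit (φ i)) → (∀ i j → N i j ≈ w j · φ i) →
                           (∀ i j → M i j ≈ N i j * N i j) →
                           Σ (Protocol m n D) λ P →
                             Protocol.UsesPureStates P × Protocol.ComputesInExpectation P M
  factorization-protocol M N φ w unit N≈wφ M≈N² = pureProtocol φ unit w
    , (λ i → unit⇒pure (φ i) (unit i))
    , λ i j → trans (Measurement.expectation-outer (w j) (φ i))
                (sym (trans (M≈N² i j) (*-cong (N≈wφ i j) (N≈wφ i j))))

  rank-protocol : ∀ {m n r} (M N : Matrix m n) → HasRank N r →
                  (∀ i j → M i j ≈ N i j * N i j) →
                  Σ (Protocol m n (suc r)) λ P →
                    Protocol.UsesPureStates P × Protocol.ComputesInExpectation P M
  rank-protocol M N rank M≈N² =
    let φ , w , unit , N≈wφ = unit-factorization N rank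
    in factorization-protocol M N φ w unit N≈wφ M≈N²

theorem16 : (ℝ : RealNumbers) →
    let open RealNumbers ℝ
        open QuantumProtocols ℝ in
    ∀ (m n r : ℕ) (M N : Matrix m n) →
    (∀ i j → 0# ≤ M i j) →
    HasRank N r →
    (∀ i j → M i j ≈ N i j * N i j) →
    Σ (Protocol m n (suc r)) λ P →
      Protocol.UsesPureStates P × Protocol.ComputesInExpectation P M
theorem16 ℝ m n r M N _ rank = LinearAlgebra.rank-protocol ℝ M N rank
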